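{- For every positive integer $n$ such that $\frac{n}{2}$ is an even integer, $\gamma(n,\frac{n}{2},\frac{n}{2})\leq\frac{n}{2}$. Moreover, there is a constant $0<\delta<1$ such that $\gamma(n,\frac{n}{2},\frac{n}{2})\geq\delta n$ whenever $n/2$ is even and $n/4$ is odd.
   Context: $[n]=\{1,\ldots,n\}$. A bicoloring of $[n]$ is a map $B:[n]\to\{ -1,+1\}$; it is a $k$-bicoloring if it takes the value $+1$ on exactly $k$ points. Put $Y_B=(B(1),\ldots,B(n))$, and for $A\subseteq[n]$ let $X_A\in\{0,1\}^n$ be its incidence vector. A non-empty set $A\subseteq[n]$ is an unbiased representative for $B$ if $\langle X_A,Y_B\rangle=0$. A family $\mathcal{A}$ of subsets of $[n]$ is a system of unbiased representatives (SUR) for a set $\mathcal{B}$ of bicolorings if every $B\in\mathcal{B}$ has an unbiased representative in $\mathcal{A}$. $\gamma(n,k,r)$ is the maximum, over all sets $\mathcal{B}$ of $k$-bicolorings of $[n]$, of the minimum cardinality of a SUR for $\mathcal{B}$ all of whose members have cardinality exactly $r$; equivalently, it is this minimum cardinality when $\mathcal{B}$ is the set of all $\binom{n}{k}$ $k$-bicolorings. -}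

module Defs where

open import Data.Fin.Subset using (Subset; Nonempty; ∣_∣)
open import Data.Bool using (if_then_else_)
open import Data.Integer using (ℤ; 0ℤ; 1ℤ; _+_; _*_; _◃_)
open import Data.List using (List; length)
open import Data.List.Membership.Propositional using (_∈_)
open import Data.List.Relation.Unary.All using (All)
open import Data.List.Relation.Unary.Unique.Propositional using (Unique)
open import Data.Nat using (ℕ; _≤_)
open import Data.Product using (∃-syntax; _×_)
open import Data.Sign using (Sign)
open import Data.Sign.Properties using (_≟_)
open import Data.Vec using (Vec; map; zipWith; foldr′; count)
open import Relation.Binary.PropositionalEquality using (_≡_)

-- A map [n] → {-1,+1} is stored as the vector of its values, so that _≡_ is
-- extensional equality; Subset does the same for subsets of [n].
Bicoloring : ℕ → Set
Bicoloring = Vec Sign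

IsKBicoloring : ∀ {n} → ℕ → Bicoloring n → Set
IsKBicoloring k B = count (_≟ Sign.+) B ≡ k

colorVector : ∀ {n} → Bicoloring n → Vec ℤ n
colorVector = map (_◃ 1)

incidenceVector : ∀ {n} → Subset n → Vec ℤ n
incidenceVector = map (λ b → if b then 1ℤ else 0ℤ)

⟨_,_⟩ : ∀ {n} → Vec ℤ n → Vec ℤ n → ℤ
⟨ x , y ⟩ = foldr′ _+_ 0ℤ (zipWith _*_ x y)

IsUnbiasedRep : ∀ {n} → Subset n → Bicoloring n → Set
IsUnbiasedRep A B = Nonempty A × ⟨ incidenceVector A , colorVector B ⟩ ≡ 0ℤ

-- Sets of bicolorings and families of subsets are finite, and are given by
-- lists of their members.
IsSUR : ∀ {n} → List (Subset n) → List (Bicoloring n) → Set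
IsSUR 𝓐 𝓑 = ∀ {B} → B ∈ 𝓑 → ∃[ A ] A ∈ 𝓐 × IsUnbiasedRep A B

-- Unique makes the length of the list 𝓐 the cardinality of the family; for 𝓑
-- only membership matters, so repetitions are harmless there.
IsUniformSUR : ∀ {n} → ℕ → List (Subset n) → List (Bicoloring n) → Set
IsUniformSUR r 𝓐 𝓑 = Unique 𝓐 × All (λ A → ∣ A ∣ ≡ r) 𝓐 × IsSUR 𝓐 𝓑

IsMinSURSize : ∀ {n} → ℕ → List (Bicoloring n) → ℕ → Set
IsMinSURSize r 𝓑 m =
  (∃[ 𝓐 ] IsUniformSUR r 𝓐 𝓑 × length 𝓐 ≡ m) ×
  (∀ 𝓐 → IsUniformSUR r 𝓐 𝓑 → m ≤ length 𝓐)

-- Isγ n k r g says γ(n,k,r) = g. It is a relation because the value is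
-- undefined when some set of k-bicolorings has no r-uniform SUR (for instance
-- when r is odd and k ≤ n); hence the minimum is required to exist for
-- every 𝓑 in the second component.
Isγ : ℕ → ℕ → ℕ → ℕ → Set
Isγ n k r g =
  (∃[ 𝓑 ] All (IsKBicoloring {n} k) 𝓑 × IsMinSURSize r 𝓑 g) ×
  (∀ 𝓑 → All (IsKBicoloring {n} k) 𝓑 → ∃[ m ] IsMinSURSize r 𝓑 m × m ≤ g)

{-# OPTIONS --safe #-}
-- Upper bound: let A_i consist of the first i points of the left half of [n]
-- and the last n/2 - i points of the right half.  The number of +1 points of B
-- in A_i changes by at most one with i, and the numbers for i = 0 and i = n/2
-- add up to n/2, so some A_i with i < n/2 is unbiased.
--
-- Lower bound: if A is an unbiased representative of size n/2 for B, then it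
-- meets B⁻¹(+1) in n/4 points, an odd number.  Hence the binary code V
-- orthogonal to a SUR of size m has no word of weight n/2.  Splitting [n] into
-- halves, the even words of V supported on one of the two halves then take at
-- most half of the possible even weights: sums of a word from each half lie in
-- V.  By the argument of Delsarte, a code of codimension m + 1 in F₂^s with ℓ
-- weights satisfies 2^s ≤ 2^(m+1) · #{u : |u| ≤ ℓ}: let p be the polynomial of
-- degree at most ℓ vanishing at the nonzero weights.  For every z, the sum of
-- p(|x|) (-1)^(z·x) over x ∈ V equals p(0) ≠ 0, but it vanishes when z is at
-- distance more than ℓ from the span of the constraints.  With ℓ about s/4
-- this forces m to be linear in n.
module Submission where

open import Defs
open import Algebra.Bundles using (AbelianGroup; CommutativeMonoid)
import Algebra.Properties.CommutativeSemigroup as CommutativeSemigroup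
import Algebra.Properties.Group as Group
open import Data.Bool as Bool using (Bool; true; false; _∧_; _xor_; if_then_else_)
open import Data.Bool.Properties using (xor-assoc)
open import Data.Fin.Subset using (Subset; ∣_∣; ⊥; ⊤; _∩_; ∁; Nonempty)
open import Data.Fin.Subset.Properties
  using (∣⊥∣≡0; ∣⊤∣≡n; ∣p∣≤n; ∩-identityˡ; anySubset?; nonempty?; Empty-unique)
open import Data.Integer using (+_)
open import Data.Integer as ℤ using (ℤ; 0ℤ; 1ℤ; -1ℤ)
import Data.Integer.Properties as ℤ
import Data.Integer.Tactic.RingSolver as ℤ-Solver
open import Data.List as List using (List; []; _∷_; length; filter; map; upTo)
open import Data.List.Membership.Propositional using (_∈_; find; lose)
open import Data.List.Membership.Propositional.Properties
  using (∈-filter⁺; ∈-filter⁻; ∈-map⁺; ∈-upTo⁺; ∈-++⁺ˡ; ∈-++⁺ʳ)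
open import Data.List.Properties using (length-filter; length-map; length-upTo)
open import Data.List.Relation.Unary.All as All using (All; []; _∷_; all?)
import Data.List.Relation.Unary.All.Properties as All
open import Data.List.Relation.Unary.AllPairs using ([]; _∷_)
open import Data.List.Relation.Unary.Any using (here; there; any?)
open import Data.List.Relation.Unary.Unique.Propositional using (Unique)
import Data.List.Relation.Unary.Unique.DecPropositional as DecUnique
import Data.List.Relation.Unary.Unique.Propositional.Properties as Unique
open import Data.Nat using (ℕ; zero; suc; _+_; _*_; _∸_; _^_; _/_; _≤_; _<_; z≤n; s≤s; NonZero)
open import Data.Nat.Divisibility using (_∣_; divides)
open import Data.Nat.DivMod using (m*n/n≡m)
open import Data.Nat.Properties
import Data.Nat.Tactic.RingSolver as ℕ-Solver
open import Data.Product using (∃-syntax; _×_; _,_; proj₂)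
import Data.Rational as ℚ
import Data.Rational.Properties as ℚ
open import Data.Rational.Unnormalised as ℚᵘ using (mkℚᵘ; *≤*)
import Data.Rational.Unnormalised.Properties as ℚᵘ
open import Data.Sign using (Sign)
open import Data.Sign.Properties using () renaming (_≟_ to _≟ˢ_)
open import Data.Sum using (_⊎_; inj₁; inj₂)
open import Data.Vec using ([]; _∷_; _++_; count; drop; splitAt; take; zipWith)
open import Data.Vec.Properties using (≡-dec; zipWith-++; ++-injectiveˡ; take++drop≡id)
open import Function using (_∘_)
open import Level using (0ℓ)
open import Relation.Binary.Definitions using (tri<; tri≈; tri>)
open import Relation.Binary.PropositionalEquality
open import Relation.Nullary using (¬_; ¬?; Dec; yes; no; contradiction; _×-dec_; map′)
open import Relation.Nullary.Decidable using (toWitness)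
open import Relation.Unary using (Pred; Decidable)

private variable
  n r : ℕ
  X : Set

-- Characters and codes with few weights

infixl 6 _⊕_
_⊕_ : Subset n → Subset n → Subset n
_⊕_ = zipWith _xor_

-- The bilinear form over F₂. In `b ∧ a` the bit of `x` comes first, so that a step computes once
-- the head of `x` is known.
parity : Subset n → Subset n → Bool
parity []      []      = false
parity (a ∷ A) (b ∷ x) = (b ∧ a) xor parity A x

module CubeSum (M : CommutativeMonoid 0ℓ 0ℓ) where
  open CommutativeMonoid M
    using (Carrier; _≈_; _∙_; ε; ∙-cong; comm; identityʳ; identityˡ; commutativeSemigroup)
    renaming (refl to ≈-refl; trans to ≈-trans; sym to ≈-sym)
  open CommutativeSemigroup commutativeSemigroup using (interchange)

  ∑ : (Subset n → Carrier) → Carrier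
  ∑ {zero}  f = f []
  ∑ {suc n} f = ∑ (f ∘ (false ∷_)) ∙ ∑ (f ∘ (true ∷_))

  ∑-cong : {f g : Subset n → Carrier} → (∀ x → f x ≈ g x) → ∑ f ≈ ∑ g
  ∑-cong {zero}  f≈g = f≈g []
  ∑-cong {suc n} f≈g = ∙-cong (∑-cong (f≈g ∘ (false ∷_))) (∑-cong (f≈g ∘ (true ∷_)))

  ∑-∙ : (f g : Subset n → Carrier) → ∑ (λ x → f x ∙ g x) ≈ ∑ f ∙ ∑ g
  ∑-∙ {zero}  f g = ≈-refl
  ∑-∙ {suc n} f g =
    ≈-trans
      (∙-cong (∑-∙ (f ∘ (false ∷_)) (g ∘ (false ∷_))) (∑-∙ (f ∘ (true ∷_)) (g ∘ (true ∷_))))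
      (interchange _ _ _ _)

  ∑-translate : (f : Subset n → Carrier) (a : Subset n) → ∑ (λ x → f (x ⊕ a)) ≈ ∑ f
  ∑-translate f []          = ≈-refl
  ∑-translate f (false ∷ a) = ∙-cong (∑-translate _ a) (∑-translate _ a)
  ∑-translate f (true ∷ a)  =
    ≈-trans (∙-cong (∑-translate _ a) (∑-translate _ a)) (comm _ _)

  ∑-zero : (f : Subset n → Carrier) → (∀ x → f x ≈ ε) → ∑ f ≈ ε
  ∑-zero {zero}  f f≈ε = f≈ε []
  ∑-zero {suc n} f f≈ε =
    ≈-trans (∙-cong (∑-zero _ (f≈ε ∘ (false ∷_))) (∑-zero _ (f≈ε ∘ (true ∷_)))) (identityˡ ε)

  ∑-at-⊥ : (f : Subset n → Carrier) → (∀ x → x ≢ ⊥ → f x ≈ ε) → ∑ f ≈ f ⊥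
  ∑-at-⊥ {zero}  f f≈ε = ≈-refl
  ∑-at-⊥ {suc n} f f≈ε =
    ≈-trans
      (∙-cong (∑-at-⊥ (f ∘ (false ∷_)) λ x x≢⊥ → f≈ε (false ∷ x) λ { refl → x≢⊥ refl })
              (∑-zero (f ∘ (true ∷_)) λ x → f≈ε (true ∷ x) λ ()))
      (identityʳ _)

open CubeSum ℤ.+-0-commutativeMonoid
open CubeSum +-0-commutativeMonoid using () renaming
  (∑ to ∑ⁿ; ∑-cong to ∑ⁿ-cong; ∑-∙ to ∑ⁿ-+; ∑-translate to ∑ⁿ-translate)

σ : Bool → ℤ
σ false = 1ℤ
σ true  = -1ℤ

σ-xor : ∀ a b → σ (a xor b) ≡ σ a ℤ.* σ b
σ-xor false false = refl
σ-xor false true  = refl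
σ-xor true  false = refl
σ-xor true  true  = refl

χ : Subset n → Subset n → ℤ
χ z x = σ (parity z x)

parity-⊥ : (z : Subset n) → parity z ⊥ ≡ false
parity-⊥ []      = refl
parity-⊥ (_ ∷ z) = parity-⊥ z

χ-⊕ : (z a x : Subset n) → χ (z ⊕ a) x ≡ χ z x ℤ.* χ a x
χ-⊕ []      []      []          = refl
χ-⊕ (b ∷ z) (c ∷ a) (false ∷ x) = χ-⊕ z a x
χ-⊕ (b ∷ z) (c ∷ a) (true ∷ x)
  rewrite σ-xor (b xor c) (parity (z ⊕ a) x) | σ-xor b c
        | σ-xor b (parity z x) | σ-xor c (parity a x) | χ-⊕ z a x =
  interchange (σ b) (σ c) (χ z x) (χ a x)
  where open CommutativeSemigroup ℤ.*-commutativeSemigroup using (interchange)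

-- Degrees by finite differences

Δ : (ℕ → ℤ) → ℕ → ℤ
Δ p k = p k ℤ.+ -1ℤ ℤ.* p (suc k)

-- Degree is expressed by vanishing of the `d`-fold difference, since this is what a character sum
-- produces: the `-1ℤ` in `Δ` is the sign `σ true`.
DegreeBelow : ℕ → (ℕ → ℤ) → Set
DegreeBelow zero    p = ∀ k → p k ≡ 0ℤ
DegreeBelow (suc d) p = DegreeBelow d (Δ p)

degree-cong : ∀ d {p q} → (∀ k → p k ≡ q k) → DegreeBelow d p → DegreeBelow d q
degree-cong zero    p≡q deg k = trans (sym (p≡q k)) (deg k)
degree-cong (suc d) p≡q       =
  degree-cong d λ k → cong₂ (λ a b → a ℤ.+ -1ℤ ℤ.* b) (p≡q k) (p≡q (suc k))

degree-shift : ∀ d p → DegreeBelow d p → DegreeBelow d (p ∘ suc)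
degree-shift zero    p deg k = deg (suc k)
degree-shift (suc d) p deg   = degree-shift d (Δ p) deg

degree-linear : ∀ d c p q → DegreeBelow d p → DegreeBelow d q →
  DegreeBelow d (λ k → p k ℤ.+ c ℤ.* q k)
degree-linear zero    c p q degp degq k rewrite degp k | degq k | ℤ.*-zeroʳ c = refl
degree-linear (suc d) c p q degp degq =
  degree-cong d (λ k → lemma (p k) (p (suc k)) (q k) (q (suc k)) c)
    (degree-linear d c (Δ p) (Δ q) degp degq)
  where
  lemma : ∀ p₀ p₁ q₀ q₁ c →
    (p₀ ℤ.+ -1ℤ ℤ.* p₁) ℤ.+ c ℤ.* (q₀ ℤ.+ -1ℤ ℤ.* q₁)
      ≡ (p₀ ℤ.+ c ℤ.* q₀) ℤ.+ -1ℤ ℤ.* (p₁ ℤ.+ c ℤ.* q₁)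
  lemma = ℤ-Solver.solve-∀

degree-Δ : ∀ d p → DegreeBelow d p → DegreeBelow d (Δ p)
degree-Δ d p deg = degree-linear d -1ℤ p (p ∘ suc) deg (degree-shift d p deg)

-- Induction by the product rule Δ((w - k) p(k)) = (w - k) Δp(k) + p(k + 1).
degree-mul : ∀ d w p → DegreeBelow d p → DegreeBelow (suc d) (λ k → (w ℤ.- + k) ℤ.* p k)
degree-mul zero    w p deg k
  rewrite deg k | deg (suc k) | ℤ.*-zeroʳ (w ℤ.- + k) | ℤ.*-zeroʳ (w ℤ.- + (suc k)) = refl
degree-mul (suc d) w p deg =
  degree-cong (suc d) (λ k → lemma w (+ k) (p k) (p (suc k)))
    (degree-linear (suc d) 1ℤ (λ k → (w ℤ.- + k) ℤ.* Δ p k) (p ∘ suc)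
      (degree-mul d w (Δ p) deg) (degree-shift (suc d) p deg))
  where
  lemma : ∀ w k p₀ p₁ →
    (w ℤ.- k) ℤ.* (p₀ ℤ.+ -1ℤ ℤ.* p₁) ℤ.+ 1ℤ ℤ.* p₁
      ≡ (w ℤ.- k) ℤ.* p₀ ℤ.+ -1ℤ ℤ.* ((w ℤ.- (1ℤ ℤ.+ k)) ℤ.* p₁)
  lemma = ℤ-Solver.solve-∀

weightPolynomial : List ℕ → ℕ → ℤ
weightPolynomial []      k = 1ℤ
weightPolynomial (w ∷ L) k = (+ w ℤ.- + k) ℤ.* weightPolynomial L k

degree-weightPolynomial : ∀ L → DegreeBelow (suc (length L)) (weightPolynomial L)
degree-weightPolynomial []      k = refl
degree-weightPolynomial (w ∷ L)   =
  degree-mul (suc (length L)) (+ w) (weightPolynomial L) (degree-weightPolynomial L)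

weightPolynomial-root : ∀ {k} L → k ∈ L → weightPolynomial L k ≡ 0ℤ
weightPolynomial-root {k} (_ ∷ L) (here refl) rewrite ℤ.+-inverseʳ (+ k) = refl
weightPolynomial-root {k} (w ∷ L) (there k∈L)
  rewrite weightPolynomial-root L k∈L = ℤ.*-zeroʳ (+ w ℤ.- + k)

weightPolynomial-0≢0 : ∀ L → All (_≢ 0) L → weightPolynomial L 0 ≢ 0ℤ
weightPolynomial-0≢0 []      []           ()
weightPolynomial-0≢0 (w ∷ L) (w≢0 ∷ L≢0) eq with ℤ.i*j≡0⇒i≡0∨j≡0 (+ w ℤ.- 0ℤ) eq
... | inj₁ w≡0 = w≢0 (ℤ.+-injective (trans (sym (ℤ.+-identityʳ (+ w))) w≡0))
... | inj₂ p≡0 = weightPolynomial-0≢0 L L≢0 p≡0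

-- Summing over one coordinate of x turns p into Δ p if z contains that
-- coordinate, so a character of weight at least d kills degree below d.
∑-radial-χ : ∀ {d} p (z : Subset n) → DegreeBelow d p → d ≤ ∣ z ∣ →
  ∑ (λ x → p ∣ x ∣ ℤ.* χ z x) ≡ 0ℤ
∑-radial-χ {d = zero} p []      deg d≤∣z∣ rewrite deg 0 = refl
∑-radial-χ {d = d}    p (b ∷ z) deg d≤∣z∣ =
  trans (trans (sym (∑-∙ (λ x → p ∣ x ∣ ℤ.* χ z x) _)) (∑-cong merge)) (rest b d deg d≤∣z∣)
  where
  merge : ∀ x → p ∣ x ∣ ℤ.* χ z x ℤ.+ p (suc ∣ x ∣) ℤ.* σ (b xor parity z x)
    ≡ (p ∣ x ∣ ℤ.+ σ b ℤ.* p (suc ∣ x ∣)) ℤ.* χ z x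
  merge x rewrite σ-xor b (parity z x) = lemma (p ∣ x ∣) (p (suc ∣ x ∣)) (σ b) (χ z x)
    where
    lemma : ∀ p₀ p₁ s c → p₀ ℤ.* c ℤ.+ p₁ ℤ.* (s ℤ.* c) ≡ (p₀ ℤ.+ s ℤ.* p₁) ℤ.* c
    lemma = ℤ-Solver.solve-∀
  rest : ∀ b d → DegreeBelow d p → d ≤ ∣ b ∷ z ∣ →
    ∑ (λ x → (p ∣ x ∣ ℤ.+ σ b ℤ.* p (suc ∣ x ∣)) ℤ.* χ z x) ≡ 0ℤ
  -- Off `z` the sign is +1: p(k) + p(k + 1) keeps the degree bound, and the tail of `z` keeps the
  -- weight.
  rest false d       deg d≤       =
    ∑-radial-χ _ z (degree-linear d 1ℤ p (p ∘ suc) deg (degree-shift d p deg)) d≤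
  -- The bound 0 cannot be lowered, but then `p` is zero and so is `Δ p`.
  rest true  zero    deg d≤       = ∑-radial-χ {d = 0} (Δ p) z (degree-Δ 0 p deg) z≤n
  rest true  (suc d) deg (s≤s d≤) = ∑-radial-χ (Δ p) z deg d≤

-- Character sums over a code

Orthogonal : List (Subset n) → Subset n → Set
Orthogonal As x = All (λ A → parity A x ≡ false) As

-- This is 2^|As| times the indicator function of the code orthogonal to `As`; the product form lets
-- each constraint split a character sum in two.
codeIndicator : List (Subset n) → Subset n → ℤ
codeIndicator []       x = 1ℤ
codeIndicator (A ∷ As) x = (1ℤ ℤ.+ χ A x) ℤ.* codeIndicator As x

codeIndicator-dichotomy : (As : List (Subset n)) (x : Subset n) →
  Orthogonal As x ⊎ codeIndicator As x ≡ 0ℤ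
codeIndicator-dichotomy []       x = inj₁ []
codeIndicator-dichotomy (A ∷ As) x with parity A x in eq
... | true  = inj₂ refl
... | false with codeIndicator-dichotomy As x
...   | inj₁ orth = inj₁ (eq ∷ orth)
...   | inj₂ ≡0 rewrite ≡0 = inj₂ refl

codeIndicator-⊥≢0 : (As : List (Subset n)) → codeIndicator As ⊥ ≢ 0ℤ
codeIndicator-⊥≢0 []       ()
codeIndicator-⊥≢0 (A ∷ As) eq rewrite parity-⊥ A with ℤ.i*j≡0⇒i≡0∨j≡0 (+ 2) eq
... | inj₂ ≡0 = codeIndicator-⊥≢0 As ≡0

∣x∣≡0⇒x≡⊥ : (x : Subset n) → ∣ x ∣ ≡ 0 → x ≡ ⊥
∣x∣≡0⇒x≡⊥ []          _  = refl
∣x∣≡0⇒x≡⊥ (false ∷ x) eq = cong (false ∷_) (∣x∣≡0⇒x≡⊥ x eq)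

-- The sum of 3^(n - |z + a|) over all sums a of subfamilies of As; the Chernoff
-- weight 3^(n - |u|) stands in for the indicator of the ball of radius ℓ, which
-- it dominates up to the factor 3^(n - ℓ).
coverage : List (Subset n) → Subset n → ℕ
coverage []       []          = 1
coverage []       (false ∷ z) = 3 * coverage [] z
coverage []       (true ∷ z)  = coverage [] z
coverage (A ∷ As) z           = coverage As z + coverage As (z ⊕ A)

-- The product form avoids truncated subtraction in 3^(n - |z|).
coverage-[] : (z : Subset n) → 3 ^ ∣ z ∣ * coverage [] z ≡ 3 ^ n
coverage-[] []          = refl
coverage-[] (false ∷ z) =
  trans (lemma (3 ^ ∣ z ∣) (coverage [] z)) (cong (3 *_) (coverage-[] z))
  where
  lemma : ∀ a b → a * (3 * b) ≡ 3 * (a * b)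
  lemma = ℕ-Solver.solve-∀
coverage-[] (true ∷ z)  = trans (*-assoc 3 (3 ^ ∣ z ∣) (coverage [] z)) (cong (3 *_) (coverage-[] z))

∑ⁿ-* : ∀ c (f : Subset n → ℕ) → ∑ⁿ (λ x → c * f x) ≡ c * ∑ⁿ f
∑ⁿ-* {zero}  c f = refl
∑ⁿ-* {suc n} c f rewrite ∑ⁿ-* c (f ∘ (false ∷_)) | ∑ⁿ-* c (f ∘ (true ∷_)) =
  sym (*-distribˡ-+ c (∑ⁿ (f ∘ (false ∷_))) _)

-- Every coordinate contributes a factor 3 + 1.
∑ⁿ-coverage-[] : ∀ n → ∑ⁿ (coverage {n} []) ≡ 4 ^ n
∑ⁿ-coverage-[] zero    = refl
∑ⁿ-coverage-[] (suc n)
  rewrite ∑ⁿ-* 3 (coverage {n} []) | ∑ⁿ-coverage-[] n = lemma (4 ^ n)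
  where
  lemma : ∀ a → 3 * a + a ≡ 4 * a
  lemma = ℕ-Solver.solve-∀

-- A translation leaves the total unchanged, so each member of `As` doubles it.
∑ⁿ-coverage : (As : List (Subset n)) → ∑ⁿ (coverage As) ≡ 2 ^ length As * 4 ^ n
∑ⁿ-coverage {n} []       = trans (∑ⁿ-coverage-[] n) (sym (*-identityˡ (4 ^ n)))
∑ⁿ-coverage {n} (A ∷ As)
  rewrite ∑ⁿ-+ (coverage As) (λ z → coverage As (z ⊕ A))
        | ∑ⁿ-translate (coverage As) A | ∑ⁿ-coverage As = lemma (2 ^ length As) (4 ^ n)
  where
  lemma : ∀ a b → a * b + a * b ≡ 2 * a * b
  lemma = ℕ-Solver.solve-∀

∑ⁿ-bound : ∀ {a} c (f : Subset n → ℕ) → (∀ x → a ≤ c * f x) → 2 ^ n * a ≤ c * ∑ⁿ f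
∑ⁿ-bound {zero}  {a} c f a≤ rewrite +-identityʳ a = a≤ []
∑ⁿ-bound {suc n} {a} c f a≤ = begin
  2 * 2 ^ n * a                                      ≡⟨ lemma (2 ^ n) a ⟩
  2 ^ n * a + 2 ^ n * a                              ≤⟨ +-mono-≤ (∑ⁿ-bound c _ (a≤ ∘ (false ∷_)))
                                                                 (∑ⁿ-bound c _ (a≤ ∘ (true ∷_))) ⟩
  c * ∑ⁿ (f ∘ (false ∷_)) + c * ∑ⁿ (f ∘ (true ∷_))  ≡⟨ *-distribˡ-+ c (∑ⁿ (f ∘ (false ∷_))) _ ⟨
  c * ∑ⁿ f                                           ∎
  where
  open ≤-Reasoning
  lemma : ∀ x a → 2 * x * a ≡ x * a + x * a
  lemma = ℕ-Solver.solve-∀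

-- The Fourier transform, at `z`, of p(|x|) weighted by `codeIndicator As`.
transform : List (Subset n) → (ℕ → ℤ) → Subset n → ℤ
transform As p z = ∑ λ x → codeIndicator As x ℤ.* (p ∣ x ∣ ℤ.* χ z x)

-- By `χ-⊕`, the factor 1 + `χ A` splits the transform in the same way as `coverage` recurses.
transform-∷ : (A : Subset n) (As : List (Subset n)) (p : ℕ → ℤ) (z : Subset n) →
  transform (A ∷ As) p z ≡ transform As p z ℤ.+ transform As p (z ⊕ A)
transform-∷ A As p z = trans (∑-cong split)
  (∑-∙ (λ x → codeIndicator As x ℤ.* (p ∣ x ∣ ℤ.* χ z x)) _)
  where
  lemma : ∀ i p c a →
    (1ℤ ℤ.+ a) ℤ.* i ℤ.* (p ℤ.* c) ≡ i ℤ.* (p ℤ.* c) ℤ.+ i ℤ.* (p ℤ.* (c ℤ.* a))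
  lemma = ℤ-Solver.solve-∀
  split : ∀ x → codeIndicator (A ∷ As) x ℤ.* (p ∣ x ∣ ℤ.* χ z x) ≡
    codeIndicator As x ℤ.* (p ∣ x ∣ ℤ.* χ z x) ℤ.+
    codeIndicator As x ℤ.* (p ∣ x ∣ ℤ.* χ (z ⊕ A) x)
  split x rewrite χ-⊕ z A x = lemma (codeIndicator As x) (p ∣ x ∣) (χ z x) (χ A x)

-- Unfolding `As` leads to the translates z + a by sums of subfamilies. One of weight at most `d`
-- already contributes 3^(n - d) to `coverage`; if there is none, `∑-radial-χ` kills every term of
-- the transform.
coverage-or-vanishing : (As : List (Subset n)) (p : ℕ → ℤ) (d : ℕ) → DegreeBelow (suc d) p →
  ∀ z → 3 ^ n ≤ 3 ^ d * coverage As z ⊎ transform As p z ≡ 0ℤ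
coverage-or-vanishing {n} [] p d deg z with ≤-<-connex ∣ z ∣ d
... | inj₁ ∣z∣≤d = inj₁ (begin
  3 ^ n                       ≡⟨ coverage-[] z ⟨
  3 ^ ∣ z ∣ * coverage [] z   ≤⟨ *-monoˡ-≤ (coverage [] z) (^-monoʳ-≤ 3 ∣z∣≤d) ⟩
  3 ^ d * coverage [] z       ∎)
  where open ≤-Reasoning
... | inj₂ d<∣z∣ =
  inj₂ (trans (∑-cong λ x → ℤ.*-identityˡ (p ∣ x ∣ ℤ.* χ z x)) (∑-radial-χ p z deg d<∣z∣))
coverage-or-vanishing (A ∷ As) p d deg z
  with coverage-or-vanishing As p d deg z | coverage-or-vanishing As p d deg (z ⊕ A)
... | inj₁ b | _      = inj₁ (≤-trans b (*-monoʳ-≤ (3 ^ d) (m≤m+n (coverage As z) _)))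
... | inj₂ _ | inj₁ b = inj₁ (≤-trans b (*-monoʳ-≤ (3 ^ d) (m≤n+m _ (coverage As z))))
... | inj₂ e | inj₂ f = inj₂ (trans (transform-∷ A As p z) (cong₂ ℤ._+_ e f))

few-weights : (As : List (Subset n)) (L : List ℕ) →
  (∀ x → Orthogonal As x → ∣ x ∣ ∈ L) →
  2 ^ n * 3 ^ n ≤ 3 ^ length L * (2 ^ length As * 4 ^ n)
few-weights {n} As L weights = begin
  2 ^ n * 3 ^ n                              ≤⟨ ∑ⁿ-bound (3 ^ length L′) (coverage As) covered ⟩
  3 ^ length L′ * ∑ⁿ (coverage As)           ≡⟨ cong (3 ^ length L′ *_) (∑ⁿ-coverage As) ⟩
  3 ^ length L′ * (2 ^ length As * 4 ^ n)    ≤⟨ *-monoˡ-≤ _ (^-monoʳ-≤ 3 (length-filter nonzero? L)) ⟩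
  3 ^ length L * (2 ^ length As * 4 ^ n)     ∎
  where
  open ≤-Reasoning
  nonzero? : ∀ w → Dec (w ≢ 0)
  nonzero? w = ¬? (w ≟ 0)
  -- The word `⊥` lies in every code, so 0 is always in `L`; it has to go, or `p` would vanish at 0.
  L′ = filter nonzero? L
  p = weightPolynomial L′

  -- `codeIndicator` kills the words outside the code and `p` kills the nonzero words inside it, so
  -- only `⊥` contributes.
  supported : ∀ z x → x ≢ ⊥ → codeIndicator As x ℤ.* (p ∣ x ∣ ℤ.* χ z x) ≡ 0ℤ
  supported z x x≢⊥ with codeIndicator-dichotomy As x
  ... | inj₂ ≡0 rewrite ≡0 = refl
  ... | inj₁ orth
    rewrite weightPolynomial-root L′
              (∈-filter⁺ nonzero? (weights x orth) (x≢⊥ ∘ ∣x∣≡0⇒x≡⊥ x)) =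
    ℤ.*-zeroʳ (codeIndicator As x)

  transform≢0 : ∀ z → transform As p z ≢ 0ℤ
  transform≢0 z eq
    with ℤ.i*j≡0⇒i≡0∨j≡0 (codeIndicator As ⊥) (trans (sym (∑-at-⊥ _ (supported z))) eq)
  ... | inj₁ ≡0 = codeIndicator-⊥≢0 As ≡0
  ... | inj₂ ≡0 rewrite ∣⊥∣≡0 n | parity-⊥ z | ℤ.*-identityʳ (p 0) =
    weightPolynomial-0≢0 L′ (All.all-filter nonzero? L) ≡0

  covered : ∀ z → 3 ^ n ≤ 3 ^ length L′ * coverage As z
  covered z with coverage-or-vanishing As p (length L′) (degree-weightPolynomial L′) z
  ... | inj₁ b  = b
  ... | inj₂ eq = contradiction eq (transform≢0 z)

-- Words of half weight

∣++∣ : ∀ {m} (x : Subset m) (y : Subset n) → ∣ x ++ y ∣ ≡ ∣ x ∣ + ∣ y ∣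
∣++∣ []          y = refl
∣++∣ (false ∷ x) y = ∣++∣ x y
∣++∣ (true ∷ x)  y = cong suc (∣++∣ x y)

parity-++ : ∀ {m} (A x : Subset m) (B y : Subset n) →
  parity (A ++ B) (x ++ y) ≡ parity A x xor parity B y
parity-++ []      []      B y = refl
parity-++ (a ∷ A) (b ∷ x) B y =
  trans (cong ((b ∧ a) xor_) (parity-++ A x B y)) (sym (xor-assoc (b ∧ a) _ _))

∣∩∣-parity : (A x : Subset n) → ∃[ i ] ∣ A ∩ x ∣ ≡ (if parity A x then 1 else 0) + 2 * i
∣∩∣-parity []          []          = 0 , refl
∣∩∣-parity (a ∷ A)     (false ∷ x) with a | ∣∩∣-parity A x
... | false | ih = ih
... | true  | ih = ih
∣∩∣-parity (false ∷ A) (true ∷ x) = ∣∩∣-parity A x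
∣∩∣-parity (true ∷ A)  (true ∷ x) with parity A x | ∣∩∣-parity A x
... | false | i , eq = i , cong suc eq
... | true  | i , eq = suc i , trans (cong suc eq) (lemma i)
  where
  lemma : ∀ i → suc (1 + 2 * i) ≡ 2 * suc i
  lemma = ℕ-Solver.solve-∀

length-filter-¬? : {P : X → Set} (P? : Decidable P) (xs : List X) →
  length (filter P? xs) + length (filter (¬? ∘ P?) xs) ≡ length xs
length-filter-¬? P? []       = refl
length-filter-¬? P? (x ∷ xs) with P? x
... | yes _ = cong suc (length-filter-¬? P? xs)
... | no _  = trans (+-suc _ _) (cong suc (length-filter-¬? P? xs))

-- For s = 4k + 2 this turns c^s into a polynomial in c^k, which the ring solver can handle.
^-twice-odd : ∀ c k → c ^ (2 * (2 * k + 1)) ≡ c * c * (c ^ k * c ^ k * (c ^ k * c ^ k))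
^-twice-odd c k = begin
  c ^ (2 * (2 * k + 1))                     ≡⟨ cong (c ^_) (exponent k) ⟩
  c ^ (2 + (k + k + (k + k)))               ≡⟨ *-assoc c c _ ⟨
  c * c * c ^ (k + k + (k + k))             ≡⟨ cong (c * c *_) (^-distribˡ-+-* c (k + k) (k + k)) ⟩
  c * c * (c ^ (k + k) * c ^ (k + k))       ≡⟨ cong (λ e → c * c * (e * e)) (^-distribˡ-+-* c k k) ⟩
  c * c * (c ^ k * c ^ k * (c ^ k * c ^ k)) ∎
  where
  open ≡-Reasoning
  exponent : ∀ k → 2 * (2 * k + 1) ≡ 2 + (k + k + (k + k))
  exponent = ℕ-Solver.solve-∀

-- With a = 2^k, b = 3^k and M = 2^m, cancelling common factors leaves 3b³ ≤ 8Ma⁴. Squaring b³ ≤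
-- 8Ma⁴ and comparing with a⁹ ≤ b⁶ gives a ≤ 64M².
codimension-bound : ∀ k m ℓ → ℓ ≤ suc k →
  2 ^ (2 * (2 * k + 1)) * 3 ^ (2 * (2 * k + 1)) ≤ 3 ^ ℓ * (2 ^ suc m * 4 ^ (2 * (2 * k + 1))) →
  k ≤ 2 * m + 6
codimension-bound k m ℓ ℓ≤1+k bound = ≮⇒≥ λ 2m+6<k →
  <⇒≱ (^-monoʳ-< 2 (s≤s (s≤s z≤n)) 2m+6<k) 2^k≤
  where
  open ≤-Reasoning
  a = 2 ^ k
  b = 3 ^ k
  M = 2 ^ m
  a⁴ = a * a * (a * a)
  common = 12 * b * a⁴
  instance
    a≢0 : NonZero a
    a≢0 = m^n≢0 2 k
    b≢0 : NonZero b
    b≢0 = m^n≢0 3 k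
    a⁴≢0 : NonZero a⁴
    a⁴≢0 = m*n≢0 (a * a) (a * a) {{m*n≢0 a a}} {{m*n≢0 a a}}
    common≢0 : NonZero common
    common≢0 = m*n≢0 (12 * b) a⁴ {{m*n≢0 12 b}}

  4^k≡a*a : 4 ^ k ≡ a * a
  4^k≡a*a = trans (^-*-assoc 2 2 k)
    (trans (cong (2 ^_) (cong (_+_ k) (+-identityʳ k))) (^-distribˡ-+-* 2 k k))

  b³≤ : b * b * b ≤ 8 * M * a⁴
  b³≤ = ≤-trans (m≤n*m (b * b * b) 3) (*-cancelˡ-≤ common (begin
    common * (3 * (b * b * b))
      ≡⟨ left a b ⟩
    2 * 2 * a⁴ * (3 * 3 * (b * b * (b * b)))
      ≡⟨ cong₂ _*_ (^-twice-odd 2 k) (^-twice-odd 3 k) ⟨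
    2 ^ (2 * (2 * k + 1)) * 3 ^ (2 * (2 * k + 1))
      ≤⟨ bound ⟩
    3 ^ ℓ * (2 * M * 4 ^ (2 * (2 * k + 1)))
      ≤⟨ *-monoˡ-≤ _ (^-monoʳ-≤ 3 ℓ≤1+k) ⟩
    3 * b * (2 * M * 4 ^ (2 * (2 * k + 1)))
      ≡⟨ cong (λ e → 3 * b * (2 * M * e)) (trans (^-twice-odd 4 k)
           (cong (λ e → 4 * 4 * (e * e * (e * e))) 4^k≡a*a)) ⟩
    3 * b * (2 * M * (4 * 4 * (a * a * (a * a) * (a * a * (a * a)))))
      ≡⟨ right a b M ⟩
    common * (8 * M * a⁴)
      ∎))
    where
    left : ∀ a b → 12 * b * (a * a * (a * a)) * (3 * (b * b * b)) ≡
      2 * 2 * (a * a * (a * a)) * (3 * 3 * (b * b * (b * b)))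
    left = ℕ-Solver.solve-∀
    right : ∀ a b M →
      3 * b * (2 * M * (4 * 4 * (a * a * (a * a) * (a * a * (a * a))))) ≡
      12 * b * (a * a * (a * a)) * (8 * M * (a * a * (a * a)))
    right = ℕ-Solver.solve-∀

  a⁹≤b⁶ : a ^ 9 ≤ b ^ 6
  a⁹≤b⁶ = begin
    a ^ 9        ≡⟨ ^-*-assoc 2 k 9 ⟩
    2 ^ (k * 9)  ≡⟨ cong (2 ^_) (*-comm k 9) ⟩
    2 ^ (9 * k)  ≡⟨ ^-*-assoc 2 9 k ⟨
    -- Here 2⁹ < 3⁶ yields one factor a beyond the a⁸ that comes from squaring.
    512 ^ k      ≤⟨ ^-monoˡ-≤ k (≤ᵇ⇒≤ 512 729 _) ⟩
    729 ^ k      ≡⟨ ^-*-assoc 3 6 k ⟩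
    3 ^ (6 * k)  ≡⟨ cong (3 ^_) (*-comm 6 k) ⟩
    3 ^ (k * 6)  ≡⟨ ^-*-assoc 3 k 6 ⟨
    b ^ 6        ∎

  2^k≤ : 2 ^ k ≤ 2 ^ (2 * m + 6)
  2^k≤ = *-cancelˡ-≤ (a⁴ * a⁴) {{m*n≢0 a⁴ a⁴}} (begin
    a⁴ * a⁴ * a                    ≡⟨ left a ⟩
    a ^ 9                          ≤⟨ a⁹≤b⁶ ⟩
    b ^ 6                          ≡⟨ middle b ⟩
    b * b * b * (b * b * b)        ≤⟨ *-mono-≤ b³≤ b³≤ ⟩
    8 * M * a⁴ * (8 * M * a⁴)      ≡⟨ right a⁴ M ⟩
    a⁴ * a⁴ * (M * M * 64)         ≡⟨ cong (λ e → a⁴ * a⁴ * (e * 64)) (^-distribˡ-+-* 2 m m) ⟨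
    a⁴ * a⁴ * (2 ^ (m + m) * 64)   ≡⟨ cong (a⁴ * a⁴ *_) (^-distribˡ-+-* 2 (m + m) 6) ⟨
    a⁴ * a⁴ * 2 ^ (m + m + 6)      ≡⟨ cong (λ e → a⁴ * a⁴ * 2 ^ (m + e + 6)) (+-identityʳ m) ⟨
    a⁴ * a⁴ * 2 ^ (2 * m + 6)      ∎)
    where
    left : ∀ a → a * a * (a * a) * (a * a * (a * a)) * a ≡
      a * (a * (a * (a * (a * (a * (a * (a * (a * 1))))))))
    left = ℕ-Solver.solve-∀
    middle : ∀ b → b * (b * (b * (b * (b * (b * 1))))) ≡ b * b * b * (b * b * b)
    middle = ℕ-Solver.solve-∀
    right : ∀ c M → 8 * M * c * (8 * M * c) ≡ c * c * (M * M * 64)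
    right = ℕ-Solver.solve-∀

even-word : (x : Subset n) → parity ⊤ x ≡ false → ∃[ i ] ∣ x ∣ ≡ 2 * i
even-word x even with i , eq ← ∣∩∣-parity ⊤ x rewrite even | ∩-identityˡ x = i , eq

half-size : ∀ t i (x : Subset (2 * t)) → ∣ x ∣ ≡ 2 * i → i ≤ t
half-size t i x eq = *-cancelˡ-≤ 2 (subst (_≤ 2 * t) eq (∣p∣≤n x))

-- If no word has weight s, then words x and y supported on the left and right
-- halves satisfy |x| ≠ s - |y|, so the even weights of one half number at most
-- half of 0, 2, …, s.
no-half-weight-word : ∀ k (let s = 2 * (2 * k + 1)) (As : List (Subset (s + s))) →
  (∀ x → Orthogonal As x → ∣ x ∣ ≢ s) → k ≤ 2 * length As + 6
no-half-weight-word k As avoid = conclude (≤-total (length lefts) (length rights))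
  where
  t = 2 * k + 1
  s = 2 * t
  -- Orthogonality to `⊤` forces even weight; it costs the extra 1 in the codimension m + 1.
  leftHalf  = ⊤ ∷ map (take s) As
  rightHalf = ⊤ ∷ map (drop s) As

  LeftWeight : ℕ → Set
  LeftWeight i = ∃[ x ] Orthogonal leftHalf x × ∣ x ∣ ≡ 2 * i

  leftWeight? : Decidable LeftWeight
  leftWeight? i = anySubset? λ x →
    all? (λ A → parity A x Bool.≟ false) leftHalf ×-dec (∣ x ∣ ≟ 2 * i)

  lefts   = filter leftWeight? (upTo (suc t))
  nonlefts = filter (¬? ∘ leftWeight?) (upTo (suc t))
  -- A right word of weight 2j excludes left words of weight 2(t - j), so these are the j that may
  -- still occur on the right.
  rights  = map (t ∸_) nonlefts

  joined : ∀ {x y} As → Orthogonal (map (take s) As) x → Orthogonal (map (drop s) As) y →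
    Orthogonal As (x ++ y)
  joined []       []       []       = []
  joined {x} {y} (A ∷ As) (p ∷ ps) (q ∷ qs) = (begin
    parity A (x ++ y)                             ≡⟨ cong (λ B → parity B (x ++ y)) (take++drop≡id s A) ⟨
    parity (take s A ++ drop s A) (x ++ y)        ≡⟨ parity-++ (take s A) x (drop s A) y ⟩
    parity (take s A) x xor parity (drop s A) y   ≡⟨ cong₂ _xor_ p q ⟩
    false                                         ∎) ∷ joined As ps qs
    where open ≡-Reasoning

  left-weights : ∀ x → Orthogonal leftHalf x → ∣ x ∣ ∈ map (2 *_) lefts
  left-weights x orth@(even ∷ _) with i , eq ← even-word x even =
    subst (_∈ map (2 *_) lefts) (sym eq)
      (∈-map⁺ (2 *_) (∈-filter⁺ leftWeight? (∈-upTo⁺ (s≤s (half-size t i x eq))) (x , orth , eq)))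

  right-weights : ∀ y → Orthogonal rightHalf y → ∣ y ∣ ∈ map (2 *_) rights
  right-weights y (even ∷ orthʸ) with j , eq ← even-word y even =
    subst (_∈ map (2 *_) rights)
      (sym (trans eq (cong (2 *_) (sym (m∸[m∸n]≡n j≤t)))))
      (∈-map⁺ (2 *_) (∈-map⁺ (t ∸_)
        (∈-filter⁺ (¬? ∘ leftWeight?) (∈-upTo⁺ (s≤s (m∸n≤m t j))) not-left)))
    where
    j≤t = half-size t j y eq
    not-left : ¬ LeftWeight (t ∸ j)
    not-left (x , (_ ∷ orthˣ) , eqˣ) = avoid (x ++ y) (joined As orthˣ orthʸ) (begin
      ∣ x ++ y ∣               ≡⟨ ∣++∣ x y ⟩
      ∣ x ∣ + ∣ y ∣            ≡⟨ cong₂ _+_ eqˣ eq ⟩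
      2 * (t ∸ j) + 2 * j      ≡⟨ *-distribˡ-+ 2 (t ∸ j) j ⟨
      2 * (t ∸ j + j)          ≡⟨ cong (2 *_) (m∸n+n≡m j≤t) ⟩
      s                        ∎)
      where open ≡-Reasoning

  -- The t + 1 = 2k + 2 candidate weights are shared out between the halves, so the shorter list has
  -- at most k + 1 entries.
  lengths : length lefts + length rights ≡ 2 * suc k
  lengths = begin
    length lefts + length rights     ≡⟨ cong (_+_ (length lefts)) (length-map (t ∸_) nonlefts) ⟩
    length lefts + length nonlefts   ≡⟨ length-filter-¬? leftWeight? (upTo (suc t)) ⟩
    length (upTo (suc t))            ≡⟨ length-upTo (suc t) ⟩
    suc (2 * k + 1)                  ≡⟨ lemma k ⟩
    2 * suc k                        ∎
    where
    open ≡-Reasoning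
    lemma : ∀ k → suc (2 * k + 1) ≡ 2 * suc k
    lemma = ℕ-Solver.solve-∀

  smaller-half : ∀ {a b} → a ≤ b → a + b ≡ 2 * suc k → a ≤ suc k
  smaller-half {a} {b} a≤b eq = *-cancelˡ-≤ 2 (begin
    2 * a     ≡⟨ cong (_+_ a) (+-identityʳ a) ⟩
    a + a     ≤⟨ +-monoʳ-≤ a a≤b ⟩
    a + b     ≡⟨ eq ⟩
    2 * suc k ∎)
    where open ≤-Reasoning

  bounded : ∀ (f : Subset (s + s) → Subset s) L → length L ≤ suc k →
    (∀ x → Orthogonal (⊤ ∷ map f As) x → ∣ x ∣ ∈ map (2 *_) L) → k ≤ 2 * length As + 6
  bounded f L short weights =
    codimension-bound k (length As) (length (map (2 *_) L))
      (subst (_≤ suc k) (sym (length-map (2 *_) L)) short)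
      (subst (λ m → 2 ^ s * 3 ^ s ≤ 3 ^ length (map (2 *_) L) * (2 ^ suc m * 4 ^ s))
        (length-map f As) (few-weights (⊤ ∷ map f As) (map (2 *_) L) weights))

  conclude : length lefts ≤ length rights ⊎ length rights ≤ length lefts → k ≤ 2 * length As + 6
  conclude (inj₁ l≤r) = bounded (take s) lefts (smaller-half l≤r lengths) left-weights
  conclude (inj₂ r≤l) =
    bounded (drop s) rights (smaller-half r≤l (trans (+-comm (length rights) _) lengths)) right-weights

-- Bicolorings and representatives

positives : Bicoloring n → Subset n
positives []           = []
positives (Sign.+ ∷ B) = true ∷ positives B
positives (Sign.- ∷ B) = false ∷ positives B

coloring : Subset n → Bicoloring n
coloring []          = []
coloring (true ∷ x)  = Sign.+ ∷ coloring x
coloring (false ∷ x) = Sign.- ∷ coloring x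

positives-coloring : (x : Subset n) → positives (coloring x) ≡ x
positives-coloring []          = refl
positives-coloring (true ∷ x)  = cong (true ∷_) (positives-coloring x)
positives-coloring (false ∷ x) = cong (false ∷_) (positives-coloring x)

∣positives∣ : (B : Bicoloring n) → ∣ positives B ∣ ≡ count (_≟ˢ Sign.+) B
∣positives∣ []           = refl
∣positives∣ (Sign.+ ∷ B) = cong suc (∣positives∣ B)
∣positives∣ (Sign.- ∷ B) = ∣positives∣ B

-- Adding 1 for each point of `A` turns its colors +1 and -1 into 2 and 0.
inner-product : (A : Subset n) (B : Bicoloring n) →
  ⟨ incidenceVector A , colorVector B ⟩ ℤ.+ + ∣ A ∣ ≡ + (2 * ∣ A ∩ positives B ∣)
inner-product []          []           = refl
inner-product (false ∷ A) (Sign.+ ∷ B) =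
  trans (cong (ℤ._+ + ∣ A ∣) (ℤ.+-identityˡ ⟨ incidenceVector A , colorVector B ⟩))
    (inner-product A B)
inner-product (false ∷ A) (Sign.- ∷ B) =
  trans (cong (ℤ._+ + ∣ A ∣) (ℤ.+-identityˡ ⟨ incidenceVector A , colorVector B ⟩))
    (inner-product A B)
inner-product (true ∷ A)  (Sign.+ ∷ B) =
  trans (lemma ⟨ incidenceVector A , colorVector B ⟩ (+ ∣ A ∣))
    (trans (cong (ℤ._+_ (+ 2)) (inner-product A B))
      (cong +_ (sym (*-suc 2 ∣ A ∩ positives B ∣))))
  where
  lemma : ∀ i a → (1ℤ ℤ.+ i) ℤ.+ (1ℤ ℤ.+ a) ≡ + 2 ℤ.+ (i ℤ.+ a)
  lemma = ℤ-Solver.solve-∀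
inner-product (true ∷ A)  (Sign.- ∷ B) =
  trans (lemma ⟨ incidenceVector A , colorVector B ⟩ (+ ∣ A ∣)) (inner-product A B)
  where
  lemma : ∀ i a → (-1ℤ ℤ.+ i) ℤ.+ (1ℤ ℤ.+ a) ≡ i ℤ.+ a
  lemma = ℤ-Solver.solve-∀

unbiased⇒half : (A : Subset n) (B : Bicoloring n) → IsUnbiasedRep A B →
  ∣ A ∣ ≡ 2 * ∣ A ∩ positives B ∣
unbiased⇒half A B (_ , ≡0) =
  ℤ.+-injective (trans (sym (ℤ.+-identityˡ (+ ∣ A ∣)))
    (trans (cong (ℤ._+ + ∣ A ∣) (sym ≡0)) (inner-product A B)))

half⇒unbiased : (A : Subset n) (B : Bicoloring n) → 0 < ∣ A ∣ →
  ∣ A ∣ ≡ 2 * ∣ A ∩ positives B ∣ → IsUnbiasedRep A B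
half⇒unbiased {n} A B 0<∣A∣ half = nonempty , +-cancelʳ (+ ∣ A ∣) _ _
  (trans (inner-product A B) (trans (cong +_ (sym half)) (sym (ℤ.+-identityˡ (+ ∣ A ∣)))))
  where
  open Group (AbelianGroup.group ℤ.+-0-abelianGroup) using () renaming (∙-cancelʳ to +-cancelʳ)
  nonempty : Nonempty A
  nonempty with nonempty? A
  ... | yes ne = ne
  ... | no ¬ne =
    contradiction (trans (cong ∣_∣ (Empty-unique ¬ne)) (∣⊥∣≡0 n)) (>⇒≢ 0<∣A∣)

-- Existence of γ by finite search

bicolorings : ∀ n → List (Bicoloring n)
bicolorings zero    = [] ∷ []
bicolorings (suc n) = map (Sign.+ ∷_) (bicolorings n) List.++ map (Sign.- ∷_) (bicolorings n)

∈-bicolorings : (B : Bicoloring n) → B ∈ bicolorings n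
∈-bicolorings []           = here refl
∈-bicolorings (Sign.+ ∷ B) = ∈-++⁺ˡ (∈-map⁺ (Sign.+ ∷_) (∈-bicolorings B))
∈-bicolorings (Sign.- ∷ B) =
  ∈-++⁺ʳ (map (Sign.+ ∷_) (bicolorings _)) (∈-map⁺ (Sign.- ∷_) (∈-bicolorings B))

isKBicoloring? : ∀ k → Decidable (IsKBicoloring {n} k)
isKBicoloring? k B = count (_≟ˢ Sign.+) B ≟ k

kBicolorings : ∀ n → ℕ → List (Bicoloring n)
kBicolorings n k = filter (isKBicoloring? k) (bicolorings n)

∈-kBicolorings : ∀ {k} {B : Bicoloring n} → IsKBicoloring k B → B ∈ kBicolorings n k
∈-kBicolorings {k = k} {B} = ∈-filter⁺ (isKBicoloring? k) (∈-bicolorings B)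

isSUR? : (𝓐 : List (Subset n)) (𝓑 : List (Bicoloring n)) → Dec (IsSUR 𝓐 𝓑)
isSUR? 𝓐 𝓑 = map′ (λ reps B∈𝓑 → find (All.lookup reps B∈𝓑))
  (λ sur → All.tabulate λ B∈𝓑 → let _ , A∈𝓐 , rep = sur B∈𝓑 in lose A∈𝓐 rep)
  (all? (λ B → any? (λ A → nonempty? A ×-dec (_ ℤ.≟ 0ℤ)) 𝓐) 𝓑)

isUniformSUR? : ∀ r (𝓑 : List (Bicoloring n)) → Decidable (λ 𝓐 → IsUniformSUR r 𝓐 𝓑)
isUniformSUR? r 𝓑 𝓐 =
  DecUnique.unique? (≡-dec Bool._≟_) 𝓐 ×-dec all? (λ A → ∣ A ∣ ≟ r) 𝓐 ×-dec isSUR? 𝓐 𝓑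

-- `Isγ` asks for attained minima, so `least` needs a decision for each size. The entries are
-- searched one at a time, each being absorbed into the predicate.
anyOfLength? : {P : Pred (List (Subset n)) 0ℓ} → Decidable P →
  ∀ m → Dec (∃[ 𝓐 ] P 𝓐 × length 𝓐 ≡ m)
anyOfLength? P? zero    =
  map′ (λ p → [] , p , refl) (λ { ([] , p , _) → p }) (P? [])
anyOfLength? P? (suc m) =
  map′ (λ (A , 𝓐 , p , eq) → A ∷ 𝓐 , p , cong suc eq)
       (λ { (A ∷ 𝓐 , p , eq) → A , 𝓐 , p , suc-injective eq })
       (anySubset? λ A → anyOfLength? (λ 𝓐 → P? (A ∷ 𝓐)) m)

least : {P : Pred ℕ 0ℓ} → Decidable P → ∀ n → P n →
  ∃[ m ] P m × m ≤ n × (∀ k → P k → m ≤ k)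
least P? n pn with P? 0
... | yes p₀ = 0 , p₀ , z≤n , λ _ _ → z≤n
least P? zero    pn | no ¬p₀ = contradiction pn ¬p₀
least P? (suc n) pn | no ¬p₀ with m , pm , m≤n , minimal ← least (P? ∘ suc) n pn =
  suc m , pm , s≤s m≤n , λ where
    zero    p → contradiction p ¬p₀
    (suc k) p → s≤s (minimal k p)

minSURSize : ∀ {r} {𝓑 : List (Bicoloring n)} (𝓐 : List (Subset n)) → IsUniformSUR r 𝓐 𝓑 →
  ∃[ m ] IsMinSURSize r 𝓑 m × m ≤ length 𝓐
minSURSize {r = r} {𝓑} 𝓐 sur
  with m , attained , m≤ , minimal ←
    least (anyOfLength? (isUniformSUR? r 𝓑)) (length 𝓐) (𝓐 , sur , refl) =
  m , (attained , λ 𝓐′ sur′ → minimal (length 𝓐′) (𝓐′ , sur′ , refl)) , m≤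

restrict-SUR : ∀ {k} {𝓐 : List (Subset n)} {𝓑} → IsUniformSUR r 𝓐 (kBicolorings n k) →
  All (IsKBicoloring k) 𝓑 → IsUniformSUR r 𝓐 𝓑
restrict-SUR (unique , sizes , sur) all-k =
  unique , sizes , λ B∈𝓑 → sur (∈-kBicolorings (All.lookup all-k B∈𝓑))

-- The set of all k-bicolorings is extremal, because a SUR for it serves every smaller set.
γ-exists : ∀ {k} (𝓐 : List (Subset n)) → IsUniformSUR r 𝓐 (kBicolorings n k) →
  ∃[ g ] Isγ n k r g × g ≤ length 𝓐
γ-exists {n} {k = k} 𝓐 sur
  with g , min@((𝓐′ , sur′ , refl) , _) , g≤ ← minSURSize 𝓐 sur =
  g ,
  ( (kBicolorings n k , All.all-filter (isKBicoloring? k) (bicolorings n) , min)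
  -- Restricting the optimal `𝓐′`, rather than `𝓐`, bounds each minimum by `g` itself.
  , λ 𝓑 all-k → minSURSize 𝓐′ (restrict-SUR sur′ all-k)) ,
  g≤

-- Applied to the set of all k-bicolorings, the bound in `Isγ` yields a concrete family, whose size
-- can then be estimated.
γ-attained : ∀ {k g} → Isγ n k r g →
  ∃[ 𝓐 ] IsUniformSUR r 𝓐 (kBicolorings n k) × length 𝓐 ≤ g
γ-attained {n} {k = k} (_ , bounded)
  with m , ((𝓐 , sur , refl) , _) , m≤g ←
    bounded (kBicolorings n k) (All.all-filter (isKBicoloring? k) (bicolorings n)) =
  𝓐 , sur , m≤g

-- The family for the upper bound

initialSegments : ∀ r → List (Subset r)
-- The full segment is left out, so there are `r` segments and not r + 1.
initialSegments zero    = []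
initialSegments (suc r) = ⊥ ∷ map (true ∷_) (initialSegments r)

length-initialSegments : ∀ r → length (initialSegments r) ≡ r
length-initialSegments zero    = refl
length-initialSegments (suc r) =
  cong suc (trans (length-map (true ∷_) (initialSegments r)) (length-initialSegments r))

unique-initialSegments : ∀ r → Unique (initialSegments r)
unique-initialSegments zero    = []
unique-initialSegments (suc r) =
  All.map⁺ (All.universal (λ _ ()) (initialSegments r)) ∷
  Unique.map⁺ (λ { refl → refl }) (unique-initialSegments r)

-- The size of the intersection of `u ++ ∁ u` with `y ++ y′`, that is, the number of +1 points in
-- A_i.
mixed : Subset r → Subset r → Subset r → ℕ
mixed u y y′ = ∣ u ∩ y ∣ + ∣ ∁ u ∩ y′ ∣

mixed-⊥ : (y y′ : Subset r) → mixed ⊥ y y′ ≡ ∣ y′ ∣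
mixed-⊥ []      []           = refl
mixed-⊥ (_ ∷ y) (false ∷ y′) = mixed-⊥ y y′
mixed-⊥ (_ ∷ y) (true ∷ y′)  = trans (+-suc _ _) (cong suc (mixed-⊥ y y′))

-- Each position lies in exactly one of `u` and `∁ u`, so the two terms together count it once for
-- `y` and once for `y′`.
mixed-swap : (u y y′ : Subset r) → mixed u y y′ + mixed u y′ y ≡ ∣ y ∣ + ∣ y′ ∣
mixed-swap []      []      []        = refl
mixed-swap (c ∷ u) (b ∷ y) (b′ ∷ y′) = step c b b′
  where
  p = ∣ u ∩ y ∣
  q = ∣ ∁ u ∩ y′ ∣
  p′ = ∣ u ∩ y′ ∣
  q′ = ∣ ∁ u ∩ y ∣
  ih : (p + q) + (p′ + q′) ≡ ∣ y ∣ + ∣ y′ ∣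
  ih = mixed-swap u y y′
  left : suc ((p + q) + (p′ + q′)) ≡ suc (∣ y ∣ + ∣ y′ ∣)
  left = cong suc ih
  right : suc ((p + q) + (p′ + q′)) ≡ ∣ y ∣ + (suc ∣ y′ ∣)
  right = trans left (sym (+-suc _ _))
  both : suc (suc ((p + q) + (p′ + q′))) ≡ suc (∣ y ∣ + (suc ∣ y′ ∣))
  both = cong suc right
  step : ∀ c b b′ →
    mixed (c ∷ u) (b ∷ y) (b′ ∷ y′) + mixed (c ∷ u) (b′ ∷ y′) (b ∷ y) ≡ ∣ b ∷ y ∣ + ∣ b′ ∷ y′ ∣
  step true  false false = ih
  step true  false true  = trans (+-suc (p + q) (p′ + q′)) right
  step true  true  false = left
  step true  true  true  = trans (cong suc (+-suc (p + q) (p′ + q′))) both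
  step false false false = ih
  step false false true  = trans (cong (_+ (p′ + q′)) (+-suc p q)) right
  step false true  false =
    trans (cong (_+_ (p + q)) (+-suc p′ q′)) (trans (+-suc (p + q) (p′ + q′)) left)
  step false true  true  =
    trans (cong₂ _+_ (+-suc p q) (+-suc p′ q′)) (trans (cong suc (+-suc (p + q) (p′ + q′))) both)

-- A discrete intermediate value theorem: lengthening u by one point changes
-- mixed u y y′ by at most one.
crossing : ∀ a c (y y′ : Subset r) → a + ∣ y′ ∣ ≤ c → c < a + ∣ y ∣ →
  ∃[ u ] u ∈ initialSegments r × a + mixed u y y′ ≡ c
-- The strict bound `above` excludes the full segment. In general `a` counts the points of `y`
-- already passed.
crossing a c []      []        below above = contradiction above (≤⇒≯ below)
crossing {suc r} a c (b ∷ y) (b′ ∷ y′) below above with a + ∣ b′ ∷ y′ ∣ ≟ c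
... | yes eq = ⊥ , here refl , trans (cong (_+_ a) (mixed-⊥ (b ∷ y) (b′ ∷ y′))) eq
... | no neq = step b above
  where
  -- Since the empty segment misses `c`, there is a slack of one, which pays for passing to `suc a`
  -- when the next point is in `y`.
  strict : a + ∣ y′ ∣ < c
  strict = ≤-<-trans (+-monoʳ-≤ a (grow b′)) (≤∧≢⇒< below neq)
    where
    grow : ∀ b′ → ∣ y′ ∣ ≤ ∣ b′ ∷ y′ ∣
    grow false = ≤-refl
    grow true  = n≤1+n ∣ y′ ∣
  step : ∀ b → c < a + ∣ b ∷ y ∣ →
    ∃[ u ] u ∈ initialSegments (suc r) × a + mixed u (b ∷ y) (b′ ∷ y′) ≡ c
  step false above with u , u∈ , eq ← crossing a c y y′ (<⇒≤ strict) above =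
    true ∷ u , there (∈-map⁺ (true ∷_) u∈) , eq
  step true above
    with u , u∈ , eq ← crossing (suc a) c y y′ strict (subst (c <_) (+-suc a ∣ y ∣) above) =
    true ∷ u , there (∈-map⁺ (true ∷_) u∈) , trans (+-suc a (mixed u y y′)) eq

balanced-segment : ∀ t (y y′ : Subset r) → 0 < r → ∣ y ∣ + ∣ y′ ∣ ≡ t + t →
  ∃[ u ] u ∈ initialSegments r × mixed u y y′ ≡ t
balanced-segment {suc r} t y y′ _ sum with <-cmp ∣ y′ ∣ t
... | tri≈ _ eq _ = ⊥ , here refl , trans (mixed-⊥ y y′) eq
... | tri< y′<t _ _ = crossing 0 t y y′ (<⇒≤ y′<t) (≰⇒> λ y≤t →
  <⇒≢ (+-mono-≤-< y≤t y′<t) sum)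
-- Here `crossing` runs with the halves exchanged; by `mixed-swap` the two counts add up to 2t, so
-- both equal `t`.
... | tri> _ _ t<y′
  with u , u∈ , eq ← crossing 0 t y′ y (≮⇒≥ λ t<y → <⇒≢ (+-mono-< t<y t<y′) (sym sum)) t<y′ =
  u , u∈ , +-cancelʳ-≡ t _ _
    (trans (cong (_+_ (mixed u y y′)) (sym eq)) (trans (mixed-swap u y y′) sum))

doubled : Subset r → Subset (r + r)
doubled u = u ++ ∁ u

∣doubled∣ : (u : Subset r) → ∣ doubled u ∣ ≡ r
∣doubled∣ {r} u = trans (∣++∣ u (∁ u)) (halves u)
  where
  halves : ∀ {r} (u : Subset r) → ∣ u ∣ + ∣ ∁ u ∣ ≡ r
  halves []          = refl
  halves (true ∷ u)  = cong suc (halves u)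
  halves (false ∷ u) = trans (+-suc ∣ u ∣ _) (cong suc (halves u))

doubledSegments : ∀ r → List (Subset (r + r))
doubledSegments r = map doubled (initialSegments r)

doubledSegments-SUR : ∀ t → 0 < 2 * t →
  IsUniformSUR (2 * t) (doubledSegments (2 * t)) (kBicolorings (2 * t + 2 * t) (2 * t))
doubledSegments-SUR t 0<s =
  Unique.map⁺ (λ {u} {v} → ++-injectiveˡ u v) (unique-initialSegments s) ,
  All.map⁺ (All.universal ∣doubled∣ (initialSegments s)) ,
  represent
  where
  open ≡-Reasoning
  s = 2 * t
  represent : IsSUR (doubledSegments s) (kBicolorings (s + s) s)
  represent {B} B∈ with y , y′ , split ← splitAt s (positives B)
    with u , u∈ , eq ← balanced-segment t y y′ 0<s (begin
      ∣ y ∣ + ∣ y′ ∣            ≡⟨ ∣++∣ y y′ ⟨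
      ∣ y ++ y′ ∣               ≡⟨ cong ∣_∣ split ⟨
      ∣ positives B ∣           ≡⟨ ∣positives∣ B ⟩
      count (_≟ˢ Sign.+) B      ≡⟨ proj₂ (∈-filter⁻ (isKBicoloring? s) {xs = bicolorings (s + s)} B∈) ⟩
      2 * t                     ≡⟨ cong (_+_ t) (+-identityʳ t) ⟩
      t + t                     ∎) =
    doubled u , ∈-map⁺ doubled u∈ ,
    half⇒unbiased (doubled u) B (subst (0 <_) (sym (∣doubled∣ u)) 0<s) (begin
      ∣ doubled u ∣                             ≡⟨ ∣doubled∣ u ⟩
      2 * t                                     ≡⟨ cong (2 *_) eq ⟨
      2 * mixed u y y′                          ≡⟨ cong (2 *_) (∣++∣ (u ∩ y) (∁ u ∩ y′)) ⟨
      2 * ∣ (u ∩ y) ++ (∁ u ∩ y′) ∣             ≡⟨ cong (λ v → 2 * ∣ v ∣) (zipWith-++ _∧_ u (∁ u) y y′) ⟨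
      2 * ∣ doubled u ∩ (y ++ y′) ∣             ≡⟨ cong (λ v → 2 * ∣ doubled u ∩ v ∣) split ⟨
      2 * ∣ doubled u ∩ positives B ∣           ∎)

γ-upper : ∀ t → 0 < 2 * t → ∃[ g ] Isγ (2 * t + 2 * t) (2 * t) (2 * t) g × g ≤ 2 * t
γ-upper t 0<s with g , isγ , g≤ ← γ-exists (doubledSegments (2 * t)) (doubledSegments-SUR t 0<s) =
  g , isγ , subst (g ≤_) (trans (length-map doubled (initialSegments (2 * t)))
                                (length-initialSegments (2 * t))) g≤

-- The linear lower bound

γ-lower : ∀ k (let s = 2 * (2 * k + 1)) {g} → Isγ (s + s) s s g → s + s ≤ 68 * g
γ-lower k {g} isγ = bound (γ-attained isγ)
  where
  s = 2 * (2 * k + 1)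
  avoid : ∀ {𝓐} → IsUniformSUR s 𝓐 (kBicolorings (s + s) s) →
    ∀ x → Orthogonal 𝓐 x → ∣ x ∣ ≢ s
  avoid (_ , sizes , sur) x orth ∣x∣≡s
    with A , A∈𝓐 , rep ← sur {coloring x} (∈-kBicolorings
      (trans (sym (∣positives∣ (coloring x))) (trans (cong ∣_∣ (positives-coloring x)) ∣x∣≡s)))
    with i , eq ← ∣∩∣-parity A x
    rewrite All.lookup orth A∈𝓐 =
    even≢odd i k (begin
      2 * i                                ≡⟨ eq ⟨
      ∣ A ∩ x ∣                            ≡⟨ cong (λ y → ∣ A ∩ y ∣) (positives-coloring x) ⟨
      ∣ A ∩ positives (coloring x) ∣       ≡⟨ *-cancelˡ-≡ _ _ 2 (trans (sym (unbiased⇒half A (coloring x) rep))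
                                                (All.lookup sizes A∈𝓐)) ⟩
      2 * k + 1                            ≡⟨ +-comm (2 * k) 1 ⟩
      suc (2 * k)                          ∎)
    where open ≡-Reasoning

  ∣⊤++⊥∣ : ∣ ⊤ {s} ++ ⊥ {s} ∣ ≡ s
  ∣⊤++⊥∣ = trans (∣++∣ (⊤ {s}) (⊥ {s})) (trans (cong₂ _+_ (∣⊤∣≡n s) (∣⊥∣≡0 s)) (+-identityʳ s))

  bound : (∃[ 𝓐 ] IsUniformSUR s 𝓐 (kBicolorings (s + s) s) × length 𝓐 ≤ g) → s + s ≤ 68 * g
  -- Every word is orthogonal to the empty family, including `⊤ ++ ⊥` of weight `s`; this makes `g`
  -- positive below.
  bound ([]        , sur , _)   = contradiction ∣⊤++⊥∣ (avoid sur (⊤ {s} ++ ⊥) [])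
  bound (𝓐@(_ ∷ _) , sur , m≤g) = begin
    s + s                      ≡⟨ expand k ⟩
    8 * k + 4                  ≤⟨ +-monoˡ-≤ 4 (*-monoʳ-≤ 8 (no-half-weight-word k 𝓐 (avoid sur))) ⟩
    8 * (2 * length 𝓐 + 6) + 4 ≤⟨ +-monoˡ-≤ 4 (*-monoʳ-≤ 8 (+-monoˡ-≤ 6 (*-monoʳ-≤ 2 m≤g))) ⟩
    8 * (2 * g + 6) + 4        ≡⟨ collect g ⟩
    -- As 1 ≤ `g`, the additive constant is absorbed: 68 = 16 + 52.
    16 * g + 52 * 1            ≤⟨ +-monoʳ-≤ (16 * g) (*-monoʳ-≤ 52 (≤-trans (s≤s z≤n) m≤g)) ⟩
    16 * g + 52 * g            ≡⟨ *-distribʳ-+ g 16 52 ⟨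
    68 * g                     ∎
    where
    open ≤-Reasoning
    expand : ∀ k → 2 * (2 * k + 1) + 2 * (2 * k + 1) ≡ 8 * k + 4
    expand = ℕ-Solver.solve-∀
    collect : ∀ g → 8 * (2 * g + 6) + 4 ≡ 16 * g + 52 * 1
    collect = ℕ-Solver.solve-∀

-- Rational constants and division by 4

slope : ℚ.ℚ
slope = + 1 ℚ./ 68

-- Unnormalised fractions expose numerators and denominators, which reduces the claim to an
-- inequality of integers.
slope-scaling : ∀ n g → n ≤ 68 * g → slope ℚ.* (+ n ℚ./ 1) ℚ.≤ (+ g ℚ./ 1)
slope-scaling n g n≤68g = ℚ.toℚᵘ-cancel-≤ (begin
  ℚ.toℚᵘ (slope ℚ.* (+ n ℚ./ 1))               ≃⟨ ℚ.toℚᵘ-homo-* slope (+ n ℚ./ 1) ⟩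
  ℚ.toℚᵘ slope ℚᵘ.* ℚ.toℚᵘ (+ n ℚ./ 1)         ≃⟨ ℚᵘ.*-congˡ {ℚ.toℚᵘ slope} (ℚ.toℚᵘ-fromℚᵘ (mkℚᵘ (+ n) 0)) ⟩
  ℚ.toℚᵘ slope ℚᵘ.* mkℚᵘ (+ n) 0               ≤⟨ *≤* scaled ⟩
  mkℚᵘ (+ g) 0                             ≃⟨ ℚ.toℚᵘ-fromℚᵘ (mkℚᵘ (+ g) 0) ⟨
  ℚ.toℚᵘ (+ g ℚ./ 1)                       ∎)
  where
  open ℚᵘ.≤-Reasoning
  scaled : + 1 ℤ.* + n ℤ.* + 1 ℤ.≤ + g ℤ.* + 68
  scaled = subst₂ ℤ._≤_
    (sym (trans (ℤ.*-identityʳ (+ 1 ℤ.* + n)) (ℤ.*-identityˡ (+ n))))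
    (trans (cong +_ (*-comm 68 g)) (ℤ.pos-* g 68))
    (ℤ.+≤+ n≤68g)

-- The form 2t + 2t suits the splitting of [n] into two halves.
quarter : ∀ {n} → 2 ∣ n → 2 ∣ n / 2 → ∃[ t ] n ≡ 2 * t + 2 * t × n / 2 ≡ 2 * t × n / 4 ≡ t
quarter (divides q refl) (divides t eq) with refl ← trans (sym (m*n/n≡m q 2)) eq =
  t , lemma t , trans eq (*-comm t 2) , trans (cong (_/ 4) (*-assoc t 2 2)) (m*n/n≡m t 4)
  where
  lemma : ∀ t → t * 2 * 2 ≡ 2 * t + 2 * t
  lemma = ℕ-Solver.solve-∀

odd : ∀ t → ¬ 2 ∣ t → ∃[ k ] t ≡ 2 * k + 1
odd zero          ¬2∣0 = contradiction (divides 0 refl) ¬2∣0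
odd (suc zero)    _    = 0 , refl
odd (suc (suc t)) ¬2∣t with k , refl ← odd t (λ { (divides q refl) → ¬2∣t (divides (suc q) refl) }) =
  suc k , lemma k
  where
  lemma : ∀ k → suc (suc (2 * k + 1)) ≡ 2 * suc k + 1
  lemma = ℕ-Solver.solve-∀

-- The variable `r` stands for `n / 2`, so that matching on `refl` can replace it by `2 * t`.
γ-half-upper : ∀ {n r} t → 0 < n → n ≡ 2 * t + 2 * t → r ≡ 2 * t → ∃[ g ] Isγ n r r g × g ≤ r
γ-half-upper zero    () refl refl
γ-half-upper (suc t) _  refl refl = γ-upper (suc t) (s≤s z≤n)

γ-half-lower : ∀ {n r g} t → n ≡ 2 * t + 2 * t → r ≡ 2 * t → ¬ 2 ∣ t → Isγ n r r g → n ≤ 68 * g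
γ-half-lower t refl refl ¬2∣t isγ with k , refl ← odd t ¬2∣t = γ-lower k isγ

theorem9 : (∀ n → 0 < n → 2 ∣ n → 2 ∣ n / 2 →
    ∃[ g ] Isγ n (n / 2) (n / 2) g × g ≤ n / 2)
    ×
    (∃[ δ ] ℚ.0ℚ ℚ.< δ × δ ℚ.< ℚ.1ℚ ×
    (∀ n → 0 < n → 2 ∣ n → 2 ∣ n / 2 → ¬ 2 ∣ n / 4 →
    ∃[ g ] Isγ n (n / 2) (n / 2) g × δ ℚ.* (+ n ℚ./ 1) ℚ.≤ (+ g ℚ./ 1)))
theorem9 =
  upper , slope , toWitness {a? = ℚ.0ℚ ℚ.<? slope} _ , toWitness {a? = slope ℚ.<? ℚ.1ℚ} _ , lower
  where
  upper : ∀ n → 0 < n → 2 ∣ n → 2 ∣ n / 2 → ∃[ g ] Isγ n (n / 2) (n / 2) g × g ≤ n / 2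
  upper n 0<n 2∣n 2∣n/2 with t , n≡ , n/2≡ , _ ← quarter 2∣n 2∣n/2 =
    γ-half-upper t 0<n n≡ n/2≡

  lower : ∀ n → 0 < n → 2 ∣ n → 2 ∣ n / 2 → ¬ 2 ∣ n / 4 →
    ∃[ g ] Isγ n (n / 2) (n / 2) g × slope ℚ.* (+ n ℚ./ 1) ℚ.≤ (+ g ℚ./ 1)
  lower n 0<n 2∣n 2∣n/2 ¬2∣n/4
    with t , n≡ , n/2≡ , n/4≡ ← quarter 2∣n 2∣n/2
    with g , isγ , _ ← upper n 0<n 2∣n 2∣n/2 =
    g , isγ , slope-scaling n g (γ-half-lower t n≡ n/2≡ (subst (λ t → ¬ 2 ∣ t) n/4≡ ¬2∣n/4) isγ)
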